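{- Let $d\geq 1$. Every infinite $d$-ary word $w$ with rationally independent letter frequencies and complexity $p_w(n)=(d-1)n+1$ for all $n\in\mathbb{N}$ is dendric.
   Context: $\mathbb{N}$ contains $0$. An infinite $d$-ary word is a sequence $w\in\{1,\ldots,d\}^{\mathbb{N}}$ in which all $d$ letters actually occur. A factor of length $n$ of $w$ is a finite word of length $n$ occurring in $w$ as a block of $n$ consecutive letters; $\mathcal{L}_n(w)$ is the set of factors of length $n$ of $w$ (with $\mathcal{L}_0(w)$ consisting of the empty word), and $p_w(n)=\mathrm{card}(\mathcal{L}_n(w))$ is the complexity of $w$. The frequency of the letter $a$ in $w$ is, if it exists, the limit $f_a=\lim_{n\to\infty}|\mathrm{pref}_n(w)|_a/n$, where $|\mathrm{pref}_n(w)|_a$ is the number of occurrences of $a$ among the first $n$ letters of $w$. The word $w$ has rationally independent letter frequencies if the frequencies $f_1,\ldots,f_d$ all exist and are linearly independent over $\mathbb{Q}$. For a factor $u\in\mathcal{L}_n(w)$, the extension graph of $u$ is the undirected bipartite graph with vertex set the disjoint union $L\sqcup R$, where $L$ is the set of letters $a$ with $au\in\mathcal{L}_{n+1}(w)$ and $R$ is the set of letters $b$ with $ub\in\mathcal{L}_{n+1}(w)$, and with an edge between $a\in L$ and $b\in R$ if and only if $aub\in\mathcal{L}_{n+2}(w)$. The word $w$ is dendric if the extension graph of each of its factors (including the empty word) is a tree, i.e. connected and acyclic. -}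

module Defs where

open import Level using (0ℓ)
open import Algebra.Bundles.Raw using (RawMonoid)
import Algebra.Definitions.RawMonoid as RawMonoidDefs
open import Data.Fin.Base as Fin using (Fin; toℕ; inject₁; fromℕ)
import Data.Fin.Properties as Fin
open import Data.Integer.Base using (+_)
open import Data.Nat.Base as ℕ using (ℕ; zero; suc)
import Data.Nat.Properties as ℕ
open import Data.Product.Base using (∃; ∃-syntax; _×_; _,_; proj₁; proj₂)
open import Data.Rational.Base as ℚ using (ℚ; 0ℚ; 1ℚ; ½)
import Data.Rational.Properties as ℚ
open import Data.Rational.Solver using (module +-*-Solver)
open import Data.Sum.Base using (_⊎_; inj₁; inj₂)
open import Data.Empty using (⊥)
open import Data.Vec.Base using (Vec; []; _∷_; _∷ʳ_; tabulate; count)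
open import Data.Vec.Properties using (∷-injective; ∷ʳ-injectiveˡ)
open import Function.Base using (_∘_)
open import Function.Bundles using (_⇔_)
open import Function.Definitions using (Injective)
open import Relation.Binary.Core using (Rel)
open import Relation.Binary.Construct.Closure.ReflexiveTransitive using (Star)
open import Relation.Binary.Definitions using (Symmetric)
open import Relation.Binary.PropositionalEquality
  using (_≡_; refl; sym; trans; cong; cong₂; subst)
open import Relation.Nullary using (¬_)
open import Relation.Unary using (Pred; _∈_)

Eventually : (ℕ → Set) → Set
Eventually P = ∃[ N ] (∀ n → N ℕ.≤ n → P n)

IsCauchy : (ℕ → ℚ) → Set
IsCauchy x = ∀ ε → 0ℚ ℚ.< ε →
  ∃[ N ] (∀ m n → N ℕ.≤ m → N ℕ.≤ n → ℚ.∣ x m ℚ.- x n ∣ ℚ.< ε)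

-- Equality of real numbers is _≈ℝ_, not _≡_.
record ℝ : Set where
  constructor mkℝ
  field
    seq    : ℕ → ℚ
    cauchy : IsCauchy seq

open ℝ public

infix 4 _≈ℝ_ _<ℝ_

_≈ℝ_ : Rel ℝ 0ℓ
x ≈ℝ y = ∀ ε → 0ℚ ℚ.< ε → Eventually λ n → ℚ.∣ seq x n ℚ.- seq y n ∣ ℚ.< ε

_<ℝ_ : Rel ℝ 0ℓ
x <ℝ y = ∃[ δ ] 0ℚ ℚ.< δ × Eventually λ n → seq x n ℚ.+ δ ℚ.< seq y n

fromℚ : ℚ → ℝ
fromℚ q = mkℝ (λ _ → q) λ ε 0<ε →
  0 , λ _ _ _ _ → subst (ℚ._< ε) (sym (cong ℚ.∣_∣ (ℚ.+-inverseʳ q))) 0<ε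

0ℝ : ℝ
0ℝ = fromℚ 0ℚ

private
  0<½* : ∀ ε → 0ℚ ℚ.< ε → 0ℚ ℚ.< ½ ℚ.* ε
  0<½* ε 0<ε = subst (ℚ._< ½ ℚ.* ε) (ℚ.*-zeroʳ ½) (ℚ.*-monoʳ-<-pos ½ 0<ε)

  ½+½ : ∀ ε → ½ ℚ.* ε ℚ.+ ½ ℚ.* ε ≡ ε
  ½+½ ε = trans (sym (ℚ.*-distribʳ-+ ε ½ ½)) (ℚ.*-identityˡ ε)

  interchange : ∀ a b c d → (a ℚ.+ b) ℚ.- (c ℚ.+ d) ≡ (a ℚ.- c) ℚ.+ (b ℚ.- d)
  interchange = solve 4 (λ a b c d →
    (a :+ b) :- (c :+ d) := (a :- c) :+ (b :- d)) refl
    where open +-*-Solver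

  scale-sub : ∀ q a b → q ℚ.* a ℚ.- q ℚ.* b ≡ q ℚ.* (a ℚ.- b)
  scale-sub = solve 3 (λ q a b → q :* a :- q :* b := q :* (a :- b)) refl
    where open +-*-Solver

  split : ∀ a b → a ≡ (a ℚ.- b) ℚ.+ b
  split = solve 2 (λ a b → a := (a :- b) :+ b) refl
    where open +-*-Solver

  cancel : ∀ a b → (a ℚ.+ b) ℚ.- b ≡ a
  cancel = solve 2 (λ a b → (a :+ b) :- b := a) refl
    where open +-*-Solver

  neg-sub : ∀ a b → ℚ.- (a ℚ.- b) ≡ b ℚ.- a
  neg-sub = solve 2 (λ a b → :- (a :- b) := b :- a) refl
    where open +-*-Solver

  ∣-∣-comm : ∀ a b → ℚ.∣ a ℚ.- b ∣ ≡ ℚ.∣ b ℚ.- a ∣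
  ∣-∣-comm a b =
    trans (sym (ℚ.∣-p∣≡∣p∣ (a ℚ.- b))) (cong ℚ.∣_∣ (neg-sub a b))

  half-triangle : ∀ a b → ℚ.∣ a ∣ ℚ.- ℚ.∣ b ∣ ℚ.≤ ℚ.∣ a ℚ.- b ∣
  half-triangle a b = begin
    ℚ.∣ a ∣ ℚ.- ℚ.∣ b ∣
      ≡⟨ cong (λ z → ℚ.∣ z ∣ ℚ.- ℚ.∣ b ∣) (split a b) ⟩
    ℚ.∣ (a ℚ.- b) ℚ.+ b ∣ ℚ.- ℚ.∣ b ∣
      ≤⟨ ℚ.+-monoˡ-≤ (ℚ.- ℚ.∣ b ∣) (ℚ.∣p+q∣≤∣p∣+∣q∣ (a ℚ.- b) b) ⟩
    (ℚ.∣ a ℚ.- b ∣ ℚ.+ ℚ.∣ b ∣) ℚ.- ℚ.∣ b ∣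
      ≡⟨ cancel ℚ.∣ a ℚ.- b ∣ ℚ.∣ b ∣ ⟩
    ℚ.∣ a ℚ.- b ∣ ∎
    where open ℚ.≤-Reasoning

  reverse-triangle : ∀ a b → ℚ.∣ ℚ.∣ a ∣ ℚ.- ℚ.∣ b ∣ ∣ ℚ.≤ ℚ.∣ a ℚ.- b ∣
  reverse-triangle a b with ℚ.∣p∣≡p∨∣p∣≡-p (ℚ.∣ a ∣ ℚ.- ℚ.∣ b ∣)
  ... | inj₁ eq = subst (ℚ._≤ ℚ.∣ a ℚ.- b ∣) (sym eq) (half-triangle a b)
  ... | inj₂ eq =
    subst (ℚ._≤ ℚ.∣ a ℚ.- b ∣)
      (sym (trans eq (neg-sub ℚ.∣ a ∣ ℚ.∣ b ∣)))
      (subst (ℚ.∣ b ∣ ℚ.- ℚ.∣ a ∣ ℚ.≤_) (∣-∣-comm b a) (half-triangle b a))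

infix 4 _⟶_
infixl 6 _+ℝ_ _-ℝ_
infixl 7 _·ℝ_

_+ℝ_ : ℝ → ℝ → ℝ
seq (x +ℝ y) n = seq x n ℚ.+ seq y n
cauchy (x +ℝ y) ε 0<ε
  with cauchy x (½ ℚ.* ε) (0<½* ε 0<ε) | cauchy y (½ ℚ.* ε) (0<½* ε 0<ε)
... | M , closeˣ | N , closeʸ = M ℕ.⊔ N , λ m n ≤m ≤n → begin-strict
  ℚ.∣ (seq x m ℚ.+ seq y m) ℚ.- (seq x n ℚ.+ seq y n) ∣
    ≡⟨ cong ℚ.∣_∣ (interchange (seq x m) (seq y m) (seq x n) (seq y n)) ⟩
  ℚ.∣ (seq x m ℚ.- seq x n) ℚ.+ (seq y m ℚ.- seq y n) ∣
    ≤⟨ ℚ.∣p+q∣≤∣p∣+∣q∣ (seq x m ℚ.- seq x n) (seq y m ℚ.- seq y n) ⟩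
  ℚ.∣ seq x m ℚ.- seq x n ∣ ℚ.+ ℚ.∣ seq y m ℚ.- seq y n ∣
    <⟨ ℚ.+-mono-<
         (closeˣ m n (ℕ.m⊔n≤o⇒m≤o M N ≤m) (ℕ.m⊔n≤o⇒m≤o M N ≤n))
         (closeʸ m n (ℕ.m⊔n≤o⇒n≤o M N ≤m) (ℕ.m⊔n≤o⇒n≤o M N ≤n)) ⟩
  ½ ℚ.* ε ℚ.+ ½ ℚ.* ε
    ≡⟨ ½+½ ε ⟩
  ε ∎
  where open ℚ.≤-Reasoning

_·ℝ_ : ℚ → ℝ → ℝ
seq (q ·ℝ x) n = q ℚ.* seq x n
cauchy (q ·ℝ x) ε 0<ε = proj₁ close , λ m n ≤m ≤n → begin-strict
  ℚ.∣ q ℚ.* seq x m ℚ.- q ℚ.* seq x n ∣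
    ≡⟨ cong ℚ.∣_∣ (scale-sub q (seq x m) (seq x n)) ⟩
  ℚ.∣ q ℚ.* (seq x m ℚ.- seq x n) ∣
    ≡⟨ ℚ.∣p*q∣≡∣p∣*∣q∣ q (seq x m ℚ.- seq x n) ⟩
  ℚ.∣ q ∣ ℚ.* ℚ.∣ seq x m ℚ.- seq x n ∣
    ≤⟨ ℚ.*-monoʳ-≤-nonNeg ℚ.∣ seq x m ℚ.- seq x n ∣
         {{ℚ.∣-∣-nonNeg (seq x m ℚ.- seq x n)}} ∣q∣≤k ⟩
  k ℚ.* ℚ.∣ seq x m ℚ.- seq x n ∣
    <⟨ ℚ.*-monoʳ-<-pos k (proj₂ close m n ≤m ≤n) ⟩
  k ℚ.* (1/k ℚ.* ε)
    ≡⟨ sym (ℚ.*-assoc k 1/k ε) ⟩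
  (k ℚ.* 1/k) ℚ.* ε
    ≡⟨ cong (ℚ._* ε) (ℚ.*-inverseʳ k) ⟩
  1ℚ ℚ.* ε
    ≡⟨ ℚ.*-identityˡ ε ⟩
  ε ∎
  where
  open ℚ.≤-Reasoning
  k : ℚ
  k = ℚ.∣ q ∣ ℚ.+ 1ℚ
  instance
    k-pos : ℚ.Positive k
    k-pos = ℚ.nonNeg+pos⇒pos ℚ.∣ q ∣ {{ℚ.∣-∣-nonNeg q}} 1ℚ
    k-nonZero : ℚ.NonZero k
    k-nonZero = ℚ.pos⇒nonZero k
  1/k : ℚ
  1/k = ℚ.1/ k
  instance
    1/k-pos : ℚ.Positive 1/k
    1/k-pos = ℚ.1/pos⇒pos k
  ∣q∣≤k : ℚ.∣ q ∣ ℚ.≤ k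
  ∣q∣≤k = subst (ℚ._≤ k) (ℚ.+-identityʳ ℚ.∣ q ∣)
    (ℚ.+-monoʳ-≤ ℚ.∣ q ∣ (ℚ.nonNegative⁻¹ 1ℚ))
  close = cauchy x (1/k ℚ.* ε)
    (subst (ℚ._< 1/k ℚ.* ε) (ℚ.*-zeroʳ 1/k) (ℚ.*-monoʳ-<-pos 1/k 0<ε))

_-ℝ_ : ℝ → ℝ → ℝ
x -ℝ y = x +ℝ (ℚ.- 1ℚ) ·ℝ y

∣_∣ℝ : ℝ → ℝ
seq ∣ x ∣ℝ n = ℚ.∣ seq x n ∣
cauchy ∣ x ∣ℝ ε 0<ε with cauchy x ε 0<ε
... | N , close = N , λ m n ≤m ≤n →
  ℚ.≤-<-trans (reverse-triangle (seq x m) (seq x n)) (close m n ≤m ≤n)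

ℝ-rawMonoid : RawMonoid 0ℓ 0ℓ
ℝ-rawMonoid = record { Carrier = ℝ ; _≈_ = _≈ℝ_ ; _∙_ = _+ℝ_ ; ε = 0ℝ }

sumℝ : ∀ {n} → (Fin n → ℝ) → ℝ
sumℝ = RawMonoidDefs.sum ℝ-rawMonoid

_⟶_ : (ℕ → ℚ) → ℝ → Set
s ⟶ x = ∀ ε → 0ℚ ℚ.< ε →
  Eventually λ n → ∣ fromℚ (s n) -ℝ x ∣ℝ <ℝ fromℚ ε

LinearlyIndependentOverℚ : ∀ {n} → (Fin n → ℝ) → Set
LinearlyIndependentOverℚ {n} x =
  ∀ (q : Fin n → ℚ) → sumℝ (λ i → q i ·ℝ x i) ≈ℝ 0ℝ → ∀ i → q i ≡ 0ℚ

-- The alphabet {1,…,d} is represented by Fin d.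
record InfiniteWord (d : ℕ) : Set where
  field
    letter   : ℕ → Fin d
    allOccur : ∀ a → ∃[ i ] letter i ≡ a

open InfiniteWord public

module _ {d : ℕ} (w : InfiniteWord d) where

  block : ℕ → (n : ℕ) → Vec (Fin d) n
  block i n = tabulate λ j → letter w (i ℕ.+ toℕ j)

  prefix : (n : ℕ) → Vec (Fin d) n
  prefix = block 0

  𝓛 : (n : ℕ) → Pred (Vec (Fin d) n) 0ℓ
  𝓛 n u = ∃[ i ] block i n ≡ u

-- The subset P of A has exactly k elements: it is the image of an injection
-- from Fin k.
HasCardinality : {A : Set} → Pred A 0ℓ → ℕ → Set
HasCardinality {A} P k =
  ∃[ e ] Injective {A = Fin k} {B = A} _≡_ _≡_ e × (∀ u → u ∈ P ⇔ (∃[ i ] e i ≡ u))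

-- p_w(n) = k
HasComplexity : ∀ {d} → InfiniteWord d → ℕ → ℕ → Set
HasComplexity w n k = HasCardinality (𝓛 w n) k

-- The sequence |pref_n(w)|_a / n is taken over n ≥ 1 to avoid dividing by 0.
IsFrequency : ∀ {d} → InfiniteWord d → Fin d → ℝ → Set
IsFrequency w a f =
  (λ n → + count (Fin._≟ a) (prefix w (suc n)) ℚ./ suc n) ⟶ f

RationallyIndependentFrequencies : ∀ {d} → InfiniteWord d → Set
RationallyIndependentFrequencies {d} w =
  ∃[ f ] (∀ (a : Fin d) → IsFrequency w a (f a)) × LinearlyIndependentOverℚ f

-- Simple undirected graphs whose vertices form a subset of V.
record Graph (V : Set) : Set₁ where
  field
    Vertex      : Pred V 0ℓ
    Edge        : Rel V 0ℓ
    edge-sym    : Symmetric Edge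
    edge-irr    : ∀ {x} → ¬ Edge x x
    edge-vertex : ∀ {x y} → Edge x y → Vertex x

module _ {V : Set} (G : Graph V) where
  open Graph G

  Connected : Set
  Connected = ∀ {x y} → Vertex x → Vertex y → Star Edge x y

  -- c 0, …, c (k+2) are k+3 distinct vertices, each adjacent to the next and
  -- the last adjacent to the first.
  record Cycle : Set where
    field
      {k}       : ℕ
      c         : Fin (3 ℕ.+ k) → V
      distinct  : Injective _≡_ _≡_ c
      adjacent  : ∀ (i : Fin (2 ℕ.+ k)) → Edge (c (inject₁ i)) (c (Fin.suc i))
      closing   : Edge (c (fromℕ (2 ℕ.+ k))) (c Fin.zero)

  Acyclic : Set
  Acyclic = ¬ Cycle

  IsTree : Set
  IsTree = Connected × Acyclic

module _ {d : ℕ} (w : InfiniteWord d) where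

  private
    tabulate-∷ʳ : ∀ {A : Set} n (g : ℕ → A) →
      tabulate {n = suc n} (g ∘ toℕ) ≡ tabulate {n = n} (g ∘ toℕ) ∷ʳ g n
    tabulate-∷ʳ zero    g = refl
    tabulate-∷ʳ (suc n) g = cong (g 0 ∷_) (tabulate-∷ʳ n (g ∘ suc))

    tabulate-cong′ : ∀ {A : Set} n {g h : ℕ → A} → (∀ j → g j ≡ h j) →
      tabulate {n = n} (g ∘ toℕ) ≡ tabulate (h ∘ toℕ)
    tabulate-cong′ zero    eq = refl
    tabulate-cong′ (suc n) eq = cong₂ _∷_ (eq 0) (tabulate-cong′ n (eq ∘ suc))

    𝓛-init : ∀ {n} {v : Vec (Fin d) n} {b} → v ∷ʳ b ∈ 𝓛 w (suc n) → v ∈ 𝓛 w n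
    𝓛-init {n} {v} (i , eq) = i , ∷ʳ-injectiveˡ _ v
      (trans (sym (tabulate-∷ʳ n (λ j → letter w (i ℕ.+ j)))) eq)

    𝓛-tail : ∀ {n} {v : Vec (Fin d) n} {a} → a ∷ v ∈ 𝓛 w (suc n) → v ∈ 𝓛 w n
    𝓛-tail {n} (i , eq) = suc i ,
      trans (tabulate-cong′ n (λ j → cong (letter w) (sym (ℕ.+-suc i j))))
            (proj₂ (∷-injective eq))

  module _ {n : ℕ} (u : Vec (Fin d) n) where

    -- inj₁ and inj₂ tag the left and right copies of a letter, so that the
    -- vertex set is the disjoint union L ⊔ R.
    ExtVertex : Pred (Fin d ⊎ Fin d) 0ℓ
    ExtVertex (inj₁ a) = a ∷ u ∈ 𝓛 w (1 ℕ.+ n)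
    ExtVertex (inj₂ b) = u ∷ʳ b ∈ 𝓛 w (1 ℕ.+ n)

    ExtEdge : Rel (Fin d ⊎ Fin d) 0ℓ
    ExtEdge (inj₁ a) (inj₂ b) = a ∷ (u ∷ʳ b) ∈ 𝓛 w (2 ℕ.+ n)
    ExtEdge (inj₂ b) (inj₁ a) = a ∷ (u ∷ʳ b) ∈ 𝓛 w (2 ℕ.+ n)
    ExtEdge (inj₁ _) (inj₁ _) = ⊥
    ExtEdge (inj₂ _) (inj₂ _) = ⊥

    extensionGraph : Graph (Fin d ⊎ Fin d)
    extensionGraph = record
      { Vertex      = ExtVertex
      ; Edge        = ExtEdge
      ; edge-sym    = λ {x} {y} → edge-sym x y
      ; edge-irr    = λ {x} → edge-irr x
      ; edge-vertex = λ {x} {y} → edge-vertex x y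
      }
      where
      edge-sym : ∀ x y → ExtEdge x y → ExtEdge y x
      edge-sym (inj₁ _) (inj₂ _) e = e
      edge-sym (inj₂ _) (inj₁ _) e = e

      edge-irr : ∀ x → ¬ ExtEdge x x
      edge-irr (inj₁ _) ()
      edge-irr (inj₂ _) ()

      edge-vertex : ∀ x y → ExtEdge x y → ExtVertex x
      edge-vertex (inj₁ a) (inj₂ b) e = 𝓛-init {v = a ∷ u} e
      edge-vertex (inj₂ b) (inj₁ a) e = 𝓛-tail {v = u ∷ʳ b} e

  -- Every factor has a right extension, so an extension graph is never empty
  -- and IsTree need not exclude the empty graph.
  Dendric : Set
  Dendric = ∀ n (u : Vec (Fin d) n) → u ∈ 𝓛 w n → IsTree (extensionGraph u)

{-# OPTIONS --safe #-}
module Submission where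

-- Consider a walk on a graph whose steps carry the letters of w. If a letter weight q and
-- a vertex potential h satisfy q (letter) = h (source) − h (target) along the whole walk,
-- then Σ q over a prefix telescopes and stays bounded, so Σ q_a f_a = 0 and hence q = 0, and
-- h is constant on the walk. The d letter weights and the V potentials, modulo
-- constants, are therefore independent functions on the edges, whence d + V ≤ E + 1.
-- The Rauzy graph of order n attains equality, as E − V = p(n+1) − p(n) = d − 1.
-- If the extension graph of a factor u of length n has a cycle, one edge equation of the
-- Rauzy graph of order n + 1 follows from the others; if it is disconnected, the vertex u
-- of the Rauzy graph of order n can be split in two. Either way the inequality fails.

open import Defs
open import Data.Nat.Base using (ℕ; _+_; _*_; _∸_; _≤_)
open import Algebra.Bundles using (module CommutativeRing)
import Algebra.Properties.Group
import Algebra.Properties.Semiring.Sum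
open import Data.Bool.Base using (Bool; true; false; if_then_else_)
import Data.Bool.Properties as Bool
open import Data.Fin.Base as Fin
  using (Fin; zero; suc; toℕ; fromℕ; inject₁; punchIn; punchOut; _↑ˡ_; _↑ʳ_; splitAt)
open import Data.Fin.Properties as Fin using (any?; punchIn-punchOut)
open import Data.Integer.Base as ℤ using (+_)
import Data.Integer.Properties as ℤ
open import Data.List.Base using (List; []; _∷_; _++_; map; allFin)
open import Data.List.Membership.Propositional using () renaming (_∈_ to _∈ₗ_)
open import Data.List.Membership.Propositional.Properties
  using (∈-++⁺ˡ; ∈-++⁺ʳ; ∈-map⁺; ∈-allFin)
open import Data.List.Relation.Unary.Any using (here; there)
open import Data.Nat.Base as ℕ using (zero; suc; _<_; s<s⁻¹; s≤s⁻¹)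
import Data.Nat.Coprimality as Coprime
import Data.Nat.Properties as ℕ
open import Data.Product.Base using (∃-syntax; _×_; _,_; proj₁; proj₂)
open import Data.Product.Properties
  using (,-injectiveˡ; ,-injectiveʳ) renaming (≡-dec to ×-≡-dec)
open import Data.Rational.Base as ℚ using (ℚ; 0ℚ; 1ℚ; ½; mkℚ; *≤*; *<*)
import Data.Rational.Properties as ℚ
open import Data.Rational.Solver using (module +-*-Solver)
import Data.Rational.Unnormalised.Base as ℚᵘ
import Data.Rational.Unnormalised.Properties as ℚᵘ
open import Data.Sum.Base using (_⊎_; inj₁; inj₂)
open import Data.Sum.Properties using () renaming (≡-dec to ⊎-≡-dec)
open import Data.Vec.Base using (Vec; []; _∷_; _∷ʳ_; count; lookup; replicate; zipWith)
open import Data.Vec.Properties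
  using (lookup-zipWith; tabulate-cong; ≡-dec; ∷-injective; ∷-injectiveˡ; ∷-injectiveʳ;
         ∷ʳ-injective; ∷ʳ-injectiveˡ; ∷ʳ-injectiveʳ)
open import Function.Base using (_∘_)
open import Function.Bundles using (module Equivalence; mk⇔)
open import Function.Definitions using (Injective)
open import Level using (0ℓ)
open import Relation.Binary.Construct.Closure.ReflexiveTransitive
  using (Star; _◅_; _◅◅_; reverse) renaming (ε to ε⋆)
open import Relation.Binary.Core using (Rel)
open import Relation.Binary.Definitions using (Decidable; DecidableEquality)
open import Relation.Binary.PropositionalEquality
open import Relation.Nullary
  using (¬_; Dec; yes; no; does; contradiction; ¬?; _⊎-dec_; _×-dec_)
open import Relation.Nullary.Decidable
  using (decidable-stable; map′; does-⇔; dec-true; dec-false)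
open import Relation.Unary using (_∈_) renaming (Decidable to Decidable₁)

private
  module ∑ = Algebra.Properties.Semiring.Sum (CommutativeRing.semiring ℚ.+-*-commutativeRing)
  module ℚ+ = Algebra.Properties.Group ℚ.+-0-group

-- Homogeneous linear systems over ℚ

axpy : ∀ {m} → ℚ → Vec ℚ m → Vec ℚ m → Vec ℚ m
axpy c = zipWith (λ a b → c ℚ.* a ℚ.+ b)

-- This single identity packages additivity (`c` equal to 1) and, since it forces the zero vector to
-- be sent to 0, homogeneity.
Linear : ∀ {m} → (Vec ℚ m → ℚ) → Set
Linear L = ∀ c x y → L (axpy c x y) ≡ c ℚ.* L x ℚ.+ L y

axpy-zeros : ∀ {m} c (y : Vec ℚ m) → axpy c (replicate m 0ℚ) y ≡ y
axpy-zeros c []      = refl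
axpy-zeros c (b ∷ y) = cong₂ _∷_
  (trans (cong (ℚ._+ b) (ℚ.*-zeroʳ c)) (ℚ.+-identityˡ b)) (axpy-zeros c y)

axpy-unit : ∀ {m} c (y : Vec ℚ m) → axpy c (1ℚ ∷ replicate m 0ℚ) (0ℚ ∷ y) ≡ c ∷ y
axpy-unit c y = cong₂ _∷_
  (trans (ℚ.+-identityʳ (c ℚ.* 1ℚ)) (ℚ.*-identityʳ c)) (axpy-zeros c y)

axpy-0∷ : ∀ {m} c (x y : Vec ℚ m) → axpy c (0ℚ ∷ x) (0ℚ ∷ y) ≡ 0ℚ ∷ axpy c x y
axpy-0∷ c x y = cong (_∷ axpy c x y) (trans (ℚ.+-identityʳ (c ℚ.* 0ℚ)) (ℚ.*-zeroʳ c))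

private
  rearrange : ∀ c a a′ b b′ t →
    (c ℚ.* a ℚ.+ b) ℚ.- t ℚ.* (c ℚ.* a′ ℚ.+ b′) ≡ c ℚ.* (a ℚ.- t ℚ.* a′) ℚ.+ (b ℚ.- t ℚ.* b′)
  rearrange = solve 6 (λ c a a′ b b′ t →
    (c :* a :+ b) :- t :* (c :* a′ :+ b′) := c :* (a :- t :* a′) :+ (b :- t :* b′)) refl
    where open +-*-Solver

  pivot-row : ∀ t i p → ℚ.- (t ℚ.* i) ℚ.* p ℚ.+ t ≡ t ℚ.* (1ℚ ℚ.- i ℚ.* p)
  pivot-row = solve 3 (λ t i p → :- (t :* i) :* p :+ t := t :* (con 1ℚ :- i :* p)) refl
    where open +-*-Solver

  other-row : ∀ t i a b → ℚ.- (t ℚ.* i) ℚ.* a ℚ.+ b ≡ b ℚ.- a ℚ.* i ℚ.* t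
  other-row = solve 4 (λ t i a b → :- (t :* i) :* a :+ b := b :- a :* i :* t) refl
    where open +-*-Solver

unit : ∀ m → Vec ℚ (suc m)
unit m = 1ℚ ∷ replicate m 0ℚ

NonTrivialZero : ∀ {k m} → (Fin k → Vec ℚ m → ℚ) → Set
NonTrivialZero L = ∃[ x ] ¬ (∀ j → lookup x j ≡ 0ℚ) × (∀ r → L r x ≡ 0ℚ)

-- 1/p is arbitrary here; back-substitute requires it to invert the pivot.
module Elimination {k m} (L : Fin (suc k) → Vec ℚ (suc m) → ℚ)
  (linear : ∀ r → Linear (L r)) (r₀ : Fin (suc k)) (1/p : ℚ) where

  -- The Schur complement of the pivot. `L r (unit m)` is the coefficient of the first unknown in
  -- row `r`; when `1/p` inverts the pivot, this multiple of row `r₀` cancels it.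
  reduced : Fin k → Vec ℚ m → ℚ
  reduced s y =
    L (punchIn r₀ s) (0ℚ ∷ y) ℚ.- L (punchIn r₀ s) (unit m) ℚ.* 1/p ℚ.* L r₀ (0ℚ ∷ y)

  private
    linear₀ : ∀ r c x y → L r (0ℚ ∷ axpy c x y) ≡ c ℚ.* L r (0ℚ ∷ x) ℚ.+ L r (0ℚ ∷ y)
    linear₀ r c x y = trans (cong (L r) (sym (axpy-0∷ c x y))) (linear r c (0ℚ ∷ x) (0ℚ ∷ y))

  reduced-linear : ∀ s → Linear (reduced s)
  reduced-linear s c x y = trans
    (cong₂ (λ a b → a ℚ.- L (punchIn r₀ s) (unit m) ℚ.* 1/p ℚ.* b)
      (linear₀ (punchIn r₀ s) c x y) (linear₀ r₀ c x y))
    (rearrange c (L (punchIn r₀ s) (0ℚ ∷ x)) (L r₀ (0ℚ ∷ x))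
      (L (punchIn r₀ s) (0ℚ ∷ y)) (L r₀ (0ℚ ∷ y)) (L (punchIn r₀ s) (unit m) ℚ.* 1/p))

  -- The first unknown is solved from the pivot row. With that value every other row agrees with its
  -- reduced row, which vanishes at `y`.
  back-substitute : 1/p ℚ.* L r₀ (unit m) ≡ 1ℚ → NonTrivialZero reduced → NonTrivialZero L
  back-substitute inverse (y , y≢0 , reduced≡0) =
    x₀ ∷ y , (λ x≡0 → y≢0 (λ j → x≡0 (suc j))) , vanishes
    where
    t x₀ : ℚ
    t  = L r₀ (0ℚ ∷ y)
    x₀ = ℚ.- (t ℚ.* 1/p)

    expand : ∀ r → L r (x₀ ∷ y) ≡ x₀ ℚ.* L r (unit m) ℚ.+ L r (0ℚ ∷ y)
    expand r = trans (cong (L r) (sym (axpy-unit x₀ y))) (linear r x₀ (unit m) (0ℚ ∷ y))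

    pivot-vanishes : L r₀ (x₀ ∷ y) ≡ 0ℚ
    pivot-vanishes = trans (expand r₀) (trans (pivot-row t 1/p (L r₀ (unit m)))
      (trans (cong (λ z → t ℚ.* (1ℚ ℚ.- z)) inverse) (ℚ.*-zeroʳ t)))

    vanishes : ∀ r → L r (x₀ ∷ y) ≡ 0ℚ
    vanishes r with r₀ Fin.≟ r
    ... | yes refl = pivot-vanishes
    ... | no r₀≢r  = subst (λ r → L r (x₀ ∷ y) ≡ 0ℚ) (punchIn-punchOut r₀≢r)
      (trans (expand s) (trans (other-row t 1/p (L s (unit m)) (L s (0ℚ ∷ y)))
        (reduced≡0 (punchOut r₀≢r))))
      where
      s : Fin _
      s = punchIn r₀ (punchOut r₀≢r)

nonTrivialZero : ∀ {k m} → k < m → (L : Fin k → Vec ℚ m → ℚ) → (∀ r → Linear (L r)) →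
  NonTrivialZero L
nonTrivialZero {k} {suc m} k<m L linear
  with any? (λ r → ¬? (L r (unit m) ℚ.≟ 0ℚ))
-- No equation involves the first unknown, so the first unit vector solves them all. This case
-- includes `k` equal to 0, where the induction ends.
... | no ∄pivot = unit m , (λ x≡0 → contradiction (x≡0 zero) λ ()) ,
  λ r → decidable-stable (_ ℚ.≟ 0ℚ) λ ≢0 → ∄pivot (r , ≢0)
nonTrivialZero {suc k} {suc m} k<m L linear | yes (r₀ , p≢0) =
  back-substitute (ℚ.*-inverseˡ p) (nonTrivialZero (s<s⁻¹ k<m) reduced reduced-linear)
  where
  p : ℚ
  p = L r₀ (unit m)
  instance
    p-nonZero : ℚ.NonZero p
    p-nonZero = ℚ.≢-nonZero p≢0
  open Elimination L linear r₀ (ℚ.1/ p)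

-- Reachability

-- Floyd–Warshall: paths whose inner vertices lie in a given list.
module Reachability {V : Set} (_~_ : Rel V 0ℓ) where

  Via : List V → Rel V 0ℓ
  Via []       x y = x ≡ y ⊎ x ~ y
  Via (z ∷ zs) x y = Via zs x y ⊎ (Via zs x z × Via zs z y)

  via? : DecidableEquality V → Decidable _~_ → ∀ zs → Decidable (Via zs)
  via? _≟_ _~?_ []       x y = (x ≟ y) ⊎-dec (x ~? y)
  via? _≟_ _~?_ (z ∷ zs) x y =
    via? _≟_ _~?_ zs x y ⊎-dec (via? _≟_ _~?_ zs x z ×-dec via? _≟_ _~?_ zs z y)

  via⇒star : ∀ zs {x y} → Via zs x y → Star _~_ x y
  via⇒star []       (inj₁ refl)    = ε⋆
  via⇒star []       (inj₂ e)       = e ◅ ε⋆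
  via⇒star (z ∷ zs) (inj₁ p)       = via⇒star zs p
  via⇒star (z ∷ zs) (inj₂ (p , q)) = via⇒star zs p ◅◅ via⇒star zs q

  edge⇒via : ∀ zs {x y} → x ~ y → Via zs x y
  edge⇒via []       e = inj₂ e
  edge⇒via (z ∷ zs) e = inj₁ (edge⇒via zs e)

  via-refl : ∀ zs {x} → Via zs x x
  via-refl []       = inj₁ refl
  via-refl (z ∷ zs) = inj₁ (via-refl zs)

  -- If the meeting vertex is the head of the list, loops at it are dropped and the outer halves
  -- joined. If it is deeper, the halves are joined by induction, and a middle stretch from the head
  -- back to itself is cut out.
  via-trans : ∀ {zs x y z} → y ∈ₗ zs → Via zs x y → Via zs y z → Via zs x z
  via-trans (here refl) (inj₁ p)       (inj₁ q)       = inj₂ (p , q)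
  via-trans (here refl) (inj₁ p)       (inj₂ (_ , q)) = inj₂ (p , q)
  via-trans (here refl) (inj₂ (p , _)) (inj₁ q)       = inj₂ (p , q)
  via-trans (here refl) (inj₂ (p , _)) (inj₂ (_ , q)) = inj₂ (p , q)
  via-trans (there y∈)  (inj₁ p)       (inj₁ q)       = inj₁ (via-trans y∈ p q)
  via-trans (there y∈)  (inj₁ p)       (inj₂ (q , r)) = inj₂ (via-trans y∈ p q , r)
  via-trans (there y∈)  (inj₂ (p , q)) (inj₁ r)       = inj₂ (p , via-trans y∈ q r)
  via-trans (there y∈)  (inj₂ (p , _)) (inj₂ (_ , r)) = inj₂ (p , r)

-- Limits of letter averages

infix 4 _↝_

-- Convergence with the real inequality replaced by rational ones on approximants, without the
-- margin that `_<ℝ_` carries; sums and scalings are then plain epsilon estimates.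
_↝_ : (ℕ → ℚ) → ℝ → Set
s ↝ x = ∀ ε → 0ℚ ℚ.< ε → Eventually λ n → Eventually λ m → ℚ.∣ s n ℚ.- seq x m ∣ ℚ.< ε

private
  sub-as-scaling : ∀ a b → a ℚ.+ (ℚ.- 1ℚ) ℚ.* b ≡ a ℚ.- b
  sub-as-scaling = solve 2 (λ a b → a :+ (:- con 1ℚ) :* b := a :- b) refl
    where open +-*-Solver

  sub-interchange : ∀ a b c d → (a ℚ.+ b) ℚ.- (c ℚ.+ d) ≡ (a ℚ.- c) ℚ.+ (b ℚ.- d)
  sub-interchange = solve 4 (λ a b c d →
    (a :+ b) :- (c :+ d) := (a :- c) :+ (b :- d)) refl
    where open +-*-Solver

  *-sub : ∀ q a b → q ℚ.* a ℚ.- q ℚ.* b ≡ q ℚ.* (a ℚ.- b)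
  *-sub = solve 3 (λ q a b → q :* a :- q :* b := q :* (a :- b)) refl
    where open +-*-Solver

  sub-via : ∀ a b → b ℚ.- 0ℚ ≡ a ℚ.- (a ℚ.- b)
  sub-via = solve 2 (λ a b → b :- con 0ℚ := a :- (a :- b)) refl
    where open +-*-Solver

  0<*pos : ∀ p ε .{{_ : ℚ.Positive p}} → 0ℚ ℚ.< ε → 0ℚ ℚ.< p ℚ.* ε
  0<*pos p ε 0<ε = subst (ℚ._< p ℚ.* ε) (ℚ.*-zeroʳ p) (ℚ.*-monoʳ-<-pos p 0<ε)

  half+half : ∀ ε → ½ ℚ.* ε ℚ.+ ½ ℚ.* ε ≡ ε
  half+half ε = trans (sym (ℚ.*-distribʳ-+ ε ½ ½)) (ℚ.*-identityˡ ε)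

⟶⇒↝ : ∀ {s x} → s ⟶ x → s ↝ x
⟶⇒↝ {s} {x} s⟶x ε 0<ε with s⟶x ε 0<ε
... | N , close = N , λ n N≤n → let δ , 0<δ , M , below = close n N≤n in
  M , λ m M≤m → begin-strict
    ℚ.∣ s n ℚ.- seq x m ∣
      ≡⟨ cong ℚ.∣_∣ (sym (sub-as-scaling (s n) (seq x m))) ⟩
    ℚ.∣ s n ℚ.+ (ℚ.- 1ℚ) ℚ.* seq x m ∣
      ≡⟨ sym (ℚ.+-identityʳ _) ⟩
    ℚ.∣ s n ℚ.+ (ℚ.- 1ℚ) ℚ.* seq x m ∣ ℚ.+ 0ℚ
      <⟨ ℚ.+-monoʳ-< ℚ.∣ s n ℚ.+ (ℚ.- 1ℚ) ℚ.* seq x m ∣ 0<δ ⟩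
    ℚ.∣ s n ℚ.+ (ℚ.- 1ℚ) ℚ.* seq x m ∣ ℚ.+ δ
      <⟨ below m M≤m ⟩
    ε ∎
  where open ℚ.≤-Reasoning

↝-0 : (λ _ → 0ℚ) ↝ 0ℝ
↝-0 ε 0<ε = 0 , λ _ _ → 0 , λ _ _ → 0<ε

↝-+ : ∀ {s t x y} → s ↝ x → t ↝ y → (λ n → s n ℚ.+ t n) ↝ x +ℝ y
↝-+ {s} {t} {x} {y} s↝x t↝y ε 0<ε
  with s↝x (½ ℚ.* ε) (0<*pos ½ ε 0<ε) | t↝y (½ ℚ.* ε) (0<*pos ½ ε 0<ε)
... | N , closeˢ | N′ , closeᵗ = N ℕ.⊔ N′ , λ n ≤n →
  let M  , closeˢₙ = closeˢ n (ℕ.m⊔n≤o⇒m≤o N N′ ≤n)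
      M′ , closeᵗₙ = closeᵗ n (ℕ.m⊔n≤o⇒n≤o N N′ ≤n)
  in M ℕ.⊔ M′ , λ m ≤m → begin-strict
    ℚ.∣ (s n ℚ.+ t n) ℚ.- (seq x m ℚ.+ seq y m) ∣
      ≡⟨ cong ℚ.∣_∣ (sub-interchange (s n) (t n) (seq x m) (seq y m)) ⟩
    ℚ.∣ (s n ℚ.- seq x m) ℚ.+ (t n ℚ.- seq y m) ∣
      ≤⟨ ℚ.∣p+q∣≤∣p∣+∣q∣ (s n ℚ.- seq x m) (t n ℚ.- seq y m) ⟩
    ℚ.∣ s n ℚ.- seq x m ∣ ℚ.+ ℚ.∣ t n ℚ.- seq y m ∣
      <⟨ ℚ.+-mono-< (closeˢₙ m (ℕ.m⊔n≤o⇒m≤o M M′ ≤m)) (closeᵗₙ m (ℕ.m⊔n≤o⇒n≤o M M′ ≤m)) ⟩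
    ½ ℚ.* ε ℚ.+ ½ ℚ.* ε
      ≡⟨ half+half ε ⟩
    ε ∎
  where open ℚ.≤-Reasoning

↝-· : ∀ q {s x} → s ↝ x → (λ n → q ℚ.* s n) ↝ q ·ℝ x
↝-· q {s} {x} s↝x ε 0<ε =
  proj₁ near , λ n N≤n → proj₁ (proj₂ near n N≤n) , λ m M≤m → begin-strict
    ℚ.∣ q ℚ.* s n ℚ.- q ℚ.* seq x m ∣
      ≡⟨ cong ℚ.∣_∣ (*-sub q (s n) (seq x m)) ⟩
    ℚ.∣ q ℚ.* (s n ℚ.- seq x m) ∣
      ≡⟨ ℚ.∣p*q∣≡∣p∣*∣q∣ q (s n ℚ.- seq x m) ⟩
    ℚ.∣ q ∣ ℚ.* ℚ.∣ s n ℚ.- seq x m ∣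
      ≤⟨ ℚ.*-monoʳ-≤-nonNeg ℚ.∣ s n ℚ.- seq x m ∣
           {{ℚ.∣-∣-nonNeg (s n ℚ.- seq x m)}} ∣q∣≤k ⟩
    k ℚ.* ℚ.∣ s n ℚ.- seq x m ∣
      <⟨ ℚ.*-monoʳ-<-pos k (proj₂ (proj₂ near n N≤n) m M≤m) ⟩
    k ℚ.* (1/k ℚ.* ε)
      ≡⟨ sym (ℚ.*-assoc k 1/k ε) ⟩
    (k ℚ.* 1/k) ℚ.* ε
      ≡⟨ cong (ℚ._* ε) (ℚ.*-inverseʳ k) ⟩
    1ℚ ℚ.* ε
      ≡⟨ ℚ.*-identityˡ ε ⟩
    ε ∎
  where
  open ℚ.≤-Reasoning
  -- The added 1 keeps the divisor positive when `q` is 0.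
  k : ℚ
  k = ℚ.∣ q ∣ ℚ.+ 1ℚ
  instance
    k-pos : ℚ.Positive k
    k-pos = ℚ.nonNeg+pos⇒pos ℚ.∣ q ∣ {{ℚ.∣-∣-nonNeg q}} 1ℚ
    k-nonZero : ℚ.NonZero k
    k-nonZero = ℚ.pos⇒nonZero k
  1/k : ℚ
  1/k = ℚ.1/ k
  instance
    1/k-pos : ℚ.Positive 1/k
    1/k-pos = ℚ.1/pos⇒pos k
  ∣q∣≤k : ℚ.∣ q ∣ ℚ.≤ k
  ∣q∣≤k = subst (ℚ._≤ k) (ℚ.+-identityʳ ℚ.∣ q ∣)
    (ℚ.+-monoʳ-≤ ℚ.∣ q ∣ (ℚ.nonNegative⁻¹ 1ℚ))
  near : Eventually λ n → Eventually λ m → ℚ.∣ s n ℚ.- seq x m ∣ ℚ.< 1/k ℚ.* ε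
  near = s↝x (1/k ℚ.* ε) (0<*pos 1/k ε 0<ε)

↝-sum : ∀ {n} {s : Fin n → ℕ → ℚ} {x : Fin n → ℝ} → (∀ a → s a ↝ x a) →
  (λ m → ∑.sum (λ a → s a m)) ↝ sumℝ x
↝-sum {zero}          s↝x = ↝-0
↝-sum {suc n} {s} {x} s↝x = ↝-+
  {s zero} {λ m → ∑.sum (λ a → s (suc a) m)} {x zero} {sumℝ (x ∘ suc)}
  (s↝x zero) (↝-sum {s = s ∘ suc} {x ∘ suc} (s↝x ∘ suc))

-- Natural numbers in ℚ and the Archimedean bound

ι : ℕ → ℚ
ι c = mkℚ (+ c) 0 (Coprime.sym (Coprime.1-coprimeTo c))

ι-suc : ∀ c → ι (suc c) ≡ 1ℚ ℚ.+ ι c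
ι-suc c = ℚ.toℚᵘ-injective (ℚᵘ.≃-trans (ℚᵘ.*≡* (eq c)) (ℚᵘ.≃-sym (ℚ.toℚᵘ-homo-+ 1ℚ (ι c))))
  where
  eq : ∀ c → + suc c ℤ.* + 1 ≡ (+ 1 ℤ.* + 1 ℤ.+ + c ℤ.* + 1) ℤ.* + 1
  eq c = cong (λ z → (+ 1 ℤ.+ z) ℤ.* + 1) (sym (ℤ.*-identityʳ (+ c)))

ι-mono-< : ∀ {m n} → m < n → ι m ℚ.< ι n
ι-mono-< {m} {n} m<n = *<* (ℤ.*-monoʳ-<-pos (+ 1) {+ m} {+ n} (ℤ.+<+ m<n))

-- A nonnegative fraction is at most its numerator, because the denominator is at least 1; a
-- negative one lies below every natural number.
p≤ι∣↥p∣ : ∀ p → p ℚ.≤ ι ℤ.∣ ℚ.↥ p ∣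
p≤ι∣↥p∣ (mkℚ (+ c)      d-1 _) = *≤* (ℤ.*-monoˡ-≤-nonNeg (+ c) (ℤ.+≤+ (ℕ.s≤s ℕ.z≤n)))
p≤ι∣↥p∣ (mkℚ ℤ.-[1+ _ ] _   _) = *≤* ℤ.-≤+

-- Abstract because unfolding 1/(n+1) computes a gcd with a variable argument.
abstract
  1/suc : ℕ → ℚ
  1/suc n = + 1 ℚ./ suc n

  fraction : ∀ c n → + c ℚ./ suc n ≡ ι c ℚ.* 1/suc n
  fraction c n = ℚ.toℚᵘ-injective (begin
    ℚ.toℚᵘ (+ c ℚ./ suc n)
      ≈⟨ ℚ.toℚᵘ-fromℚᵘ (ℚᵘ.mkℚᵘ (+ c) n) ⟩
    ℚᵘ.mkℚᵘ (+ c) n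
      ≈⟨ ℚᵘ.*≡* (cong₂ ℤ._*_ (sym (ℤ.*-identityʳ (+ c))) (cong (+_ ∘ suc) (ℕ.+-identityʳ n))) ⟩
    ℚᵘ.mkℚᵘ (+ c) 0 ℚᵘ.* ℚᵘ.mkℚᵘ (+ 1) n
      ≈⟨ ℚᵘ.*-congˡ {ℚᵘ.mkℚᵘ (+ c) 0} (ℚᵘ.≃-sym (ℚ.toℚᵘ-fromℚᵘ (ℚᵘ.mkℚᵘ (+ 1) n))) ⟩
    ℚᵘ.mkℚᵘ (+ c) 0 ℚᵘ.* ℚ.toℚᵘ (+ 1 ℚ./ suc n)
      ≈⟨ ℚᵘ.≃-sym (ℚ.toℚᵘ-homo-* (ι c) (+ 1 ℚ./ suc n)) ⟩
    ℚ.toℚᵘ (ι c ℚ.* (+ 1 ℚ./ suc n)) ∎)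
    where open import Relation.Binary.Reasoning.Setoid ℚᵘ.≃-setoid

  ι*1/suc : ∀ n → ι (suc n) ℚ.* 1/suc n ≡ 1ℚ
  ι*1/suc n = trans (sym (fraction (suc n) n)) (ℚ.toℚᵘ-injective
    (ℚᵘ.≃-trans (ℚ.toℚᵘ-fromℚᵘ (ℚᵘ.mkℚᵘ (+ suc n) n)) (ℚᵘ.*≡* (ℤ.*-comm (+ suc n) (+ 1)))))

  1/suc-pos : ∀ n → ℚ.Positive (1/suc n)
  1/suc-pos n = ℚ.normalize-pos 1 (suc n)

-- The threshold is the absolute numerator of B / ε: from there on B / ε < n + 1.
bounded/n→0 : ∀ B ε → 0ℚ ℚ.< ε → Eventually λ n → B ℚ.* 1/suc n ℚ.< ε
bounded/n→0 B ε 0<ε = ℤ.∣ ℚ.↥ p ∣ , λ n ≤n → begin-strict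
  B ℚ.* 1/suc n
    ≡⟨ cong (ℚ._* 1/suc n) B≡ ⟩
  (p ℚ.* ε) ℚ.* 1/suc n
    <⟨ ℚ.*-monoˡ-<-pos (1/suc n) {{1/suc-pos n}} (ℚ.*-monoˡ-<-pos ε
         (ℚ.≤-<-trans (p≤ι∣↥p∣ p) (ι-mono-< (ℕ.s≤s ≤n)))) ⟩
  (ι (suc n) ℚ.* ε) ℚ.* 1/suc n
    ≡⟨ swap (ι (suc n)) ε (1/suc n) ⟩
  (ι (suc n) ℚ.* 1/suc n) ℚ.* ε
    ≡⟨ cong (ℚ._* ε) (ι*1/suc n) ⟩
  1ℚ ℚ.* ε
    ≡⟨ ℚ.*-identityˡ ε ⟩
  ε ∎
  where
  open ℚ.≤-Reasoning
  instance
    ε-pos : ℚ.Positive ε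
    ε-pos = ℚ.positive 0<ε
    ε-nonZero : ℚ.NonZero ε
    ε-nonZero = ℚ.pos⇒nonZero ε
  p : ℚ
  p = B ℚ.* ℚ.1/ ε
  B≡ : B ≡ p ℚ.* ε
  B≡ = sym (trans (ℚ.*-assoc B (ℚ.1/ ε) ε)
    (trans (cong (B ℚ.*_) (ℚ.*-inverseˡ ε)) (ℚ.*-identityʳ B)))
  swap : ∀ a b c → (a ℚ.* b) ℚ.* c ≡ (a ℚ.* c) ℚ.* b
  swap = solve 3 (λ a b c → (a :* b) :* c := (a :* c) :* b) refl
    where open +-*-Solver

-- A single index `n` suffices, taken so large that the `n`-th quotient is below ε/2 in absolute
-- value and within ε/2 of all late approximants of `x`.
bounded⇒limit≈0 : ∀ {s : ℕ → ℚ} {x} B → (∀ n → ℚ.∣ s n ∣ ℚ.≤ B) →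
  (λ n → s n ℚ.* 1/suc n) ↝ x → x ≈ℝ 0ℝ
bounded⇒limit≈0 {s} {x} B ∣s∣≤B s/n↝x ε 0<ε = M , λ m M≤m → begin-strict
  ℚ.∣ seq x m ℚ.- 0ℚ ∣
    ≡⟨ cong ℚ.∣_∣ (sub-via t (seq x m)) ⟩
  ℚ.∣ t ℚ.- (t ℚ.- seq x m) ∣
    ≤⟨ ℚ.∣p-q∣≤∣p∣+∣q∣ t (t ℚ.- seq x m) ⟩
  ℚ.∣ t ∣ ℚ.+ ℚ.∣ t ℚ.- seq x m ∣
    <⟨ ℚ.+-mono-< ∣t∣< (proj₂ near m M≤m) ⟩
  ½ ℚ.* ε ℚ.+ ½ ℚ.* ε
    ≡⟨ half+half ε ⟩
  ε ∎
  where
  open ℚ.≤-Reasoning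
  close = s/n↝x (½ ℚ.* ε) (0<*pos ½ ε 0<ε)
  small = bounded/n→0 B (½ ℚ.* ε) (0<*pos ½ ε 0<ε)
  n : ℕ
  n = proj₁ close ℕ.⊔ proj₁ small
  t : ℚ
  t = s n ℚ.* 1/suc n
  near = proj₂ close n (ℕ.m≤m⊔n (proj₁ close) (proj₁ small))
  M : ℕ
  M = proj₁ near
  instance
    1/n-pos : ℚ.Positive (1/suc n)
    1/n-pos = 1/suc-pos n
    1/n-nonNeg : ℚ.NonNegative (1/suc n)
    1/n-nonNeg = ℚ.pos⇒nonNeg (1/suc n)
  ∣t∣< : ℚ.∣ t ∣ ℚ.< ½ ℚ.* ε
  ∣t∣< = begin-strict
    ℚ.∣ t ∣                      ≡⟨ ℚ.∣p*q∣≡∣p∣*∣q∣ (s n) (1/suc n) ⟩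
    ℚ.∣ s n ∣ ℚ.* ℚ.∣ 1/suc n ∣  ≡⟨ cong (ℚ.∣ s n ∣ ℚ.*_) (ℚ.0≤p⇒∣p∣≡p (ℚ.nonNegative⁻¹ (1/suc n))) ⟩
    ℚ.∣ s n ∣ ℚ.* 1/suc n        ≤⟨ ℚ.*-monoʳ-≤-nonNeg (1/suc n) (∣s∣≤B n) ⟩
    B ℚ.* 1/suc n                <⟨ proj₂ small n (ℕ.m≤n⊔m (proj₁ close) (proj₁ small)) ⟩
    ½ ℚ.* ε                      ∎

-- Weighted letter sums over prefixes

total : ∀ {A : Set} {n} → (A → ℚ) → Vec A n → ℚ
total q []       = 0ℚ
total q (x ∷ xs) = q x ℚ.+ total q xs

private
  indicator : ∀ {d} → Fin d → Fin d → ℚ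
  indicator x a = if does (x Fin.≟ a) then 1ℚ else 0ℚ

  ∑-indicator : ∀ {d} (q : Fin d → ℚ) x → ∑.sum (λ a → q a ℚ.* indicator x a) ≡ q x
  ∑-indicator {suc d} q zero = trans
    (cong₂ ℚ._+_ (ℚ.*-identityʳ (q zero)) (trans
      (∑.sum-cong-≗ (λ a → ℚ.*-zeroʳ (q (suc a)))) (∑.sum-replicate-zero d)))
    (ℚ.+-identityʳ (q zero))
  ∑-indicator {suc d} q (suc x) = trans
    (cong₂ ℚ._+_ (ℚ.*-zeroʳ (q zero)) (∑-indicator (q ∘ suc) x))
    (ℚ.+-identityˡ (q (suc x)))

  ι-count-∷ : ∀ {d n} (a x : Fin d) (xs : Vec (Fin d) n) →
    ι (count (Fin._≟ a) (x ∷ xs)) ≡ indicator x a ℚ.+ ι (count (Fin._≟ a) xs)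
  ι-count-∷ a x xs with does (x Fin.≟ a)
  ... | true  = ι-suc (count (Fin._≟ a) xs)
  ... | false = sym (ℚ.+-identityˡ (ι (count (Fin._≟ a) xs)))

∑-count : ∀ {d n} (q : Fin d → ℚ) (xs : Vec (Fin d) n) →
  ∑.sum (λ a → q a ℚ.* ι (count (Fin._≟ a) xs)) ≡ total q xs
∑-count {d} q [] = trans (∑.sum-cong-≗ (λ a → ℚ.*-zeroʳ (q a))) (∑.sum-replicate-zero d)
∑-count q (x ∷ xs) = begin
  ∑.sum (λ a → q a ℚ.* ι (count (Fin._≟ a) (x ∷ xs)))
    ≡⟨ ∑.sum-cong-≗ (λ a → trans (cong (q a ℚ.*_) (ι-count-∷ a x xs))
         (ℚ.*-distribˡ-+ (q a) (indicator x a) (ι (count (Fin._≟ a) xs)))) ⟩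
  ∑.sum (λ a → q a ℚ.* indicator x a ℚ.+ q a ℚ.* ι (count (Fin._≟ a) xs))
    ≡⟨ ∑.∑-distrib-+ (λ a → q a ℚ.* indicator x a) (λ a → q a ℚ.* ι (count (Fin._≟ a) xs)) ⟩
  ∑.sum (λ a → q a ℚ.* indicator x a) ℚ.+ ∑.sum (λ a → q a ℚ.* ι (count (Fin._≟ a) xs))
    ≡⟨ cong₂ ℚ._+_ (∑-indicator q x) (∑-count q xs) ⟩
  q x ℚ.+ total q xs ∎
  where open ≡-Reasoning

module _ {d} (w : InfiniteWord d) where

  -- The averages of `q` over prefixes converge to Σ q_a f_a because the frequencies exist, and to 0
  -- because the sums are bounded. Hence this rational combination of the frequencies vanishes.
  bounded⇒≡0 : RationallyIndependentFrequencies w → (q : Fin d → ℚ) → ∀ B →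
    (∀ n → ℚ.∣ total q (prefix w n) ∣ ℚ.≤ B) → ∀ a → q a ≡ 0ℚ
  bounded⇒≡0 (f , frequency , independent) q B bound = independent q
    (bounded⇒limit≈0 {s = λ n → total q (prefix w (suc n))} {x} B (λ n → bound (suc n)) average↝x)
    where
    x : ℝ
    x = sumℝ (λ a → q a ·ℝ f a)

    occurrences : ℕ → Fin d → ℕ
    occurrences n a = count (Fin._≟ a) (prefix w (suc n))

    mean : Fin d → ℕ → ℚ
    mean a n = + occurrences n a ℚ./ suc n

    average : ∀ n → ∑.sum (λ a → q a ℚ.* mean a n) ≡ total q (prefix w (suc n)) ℚ.* 1/suc n
    average n = begin
      ∑.sum (λ a → q a ℚ.* mean a n)
        ≡⟨ ∑.sum-cong-≗ (λ a → trans (cong (q a ℚ.*_) (fraction (occurrences n a) n))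
             (sym (ℚ.*-assoc (q a) (ι (occurrences n a)) (1/suc n)))) ⟩
      ∑.sum (λ a → q a ℚ.* ι (occurrences n a) ℚ.* 1/suc n)
        ≡⟨ sym (∑.*-distribʳ-sum (1/suc n) (λ a → q a ℚ.* ι (occurrences n a))) ⟩
      ∑.sum (λ a → q a ℚ.* ι (occurrences n a)) ℚ.* 1/suc n
        ≡⟨ cong (ℚ._* 1/suc n) (∑-count q (prefix w (suc n))) ⟩
      total q (prefix w (suc n)) ℚ.* 1/suc n ∎
      where open ≡-Reasoning

    average↝x : (λ n → total q (prefix w (suc n)) ℚ.* 1/suc n) ↝ x
    average↝x ε 0<ε =
      let N , close = ↝-sum {s = λ a n → q a ℚ.* mean a n} {x = λ a → q a ·ℝ f a}
            (λ a → ↝-· (q a) {mean a} {f a} (⟶⇒↝ {mean a} {f a} (frequency a))) ε 0<ε in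
      N , λ n N≤n → let M , below = close n N≤n in
      M , λ m M≤m → subst (λ z → ℚ.∣ z ℚ.- seq x m ∣ ℚ.< ε) (average n) (below m M≤m)

-- Labelled walks

module _ {d} (w : InfiniteWord d) where

  block-∷ : ∀ i n → block w i (suc n) ≡ letter w i ∷ block w (suc i) n
  block-∷ i n = cong₂ _∷_ (cong (letter w) (ℕ.+-identityʳ i))
    (tabulate-cong (λ j → cong (letter w) (ℕ.+-suc i (toℕ j))))

  block-∷ʳ : ∀ i n → block w i (suc n) ≡ block w i n ∷ʳ letter w (i + n)
  block-∷ʳ i zero    = refl
  block-∷ʳ i (suc n) = begin
    block w i (2 + n)
      ≡⟨ block-∷ i (suc n) ⟩
    letter w i ∷ block w (suc i) (suc n)
      ≡⟨ cong (letter w i ∷_) (block-∷ʳ (suc i) n) ⟩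
    letter w i ∷ (block w (suc i) n ∷ʳ letter w (suc i + n))
      ≡⟨ cong₂ _∷ʳ_ (sym (block-∷ i n)) (cong (letter w) (sym (ℕ.+-suc i n))) ⟩
    block w i (suc n) ∷ʳ letter w (i + suc n) ∎
    where open ≡-Reasoning

  total-telescope : (q : Fin d → ℚ) (h : ℕ → ℚ) →
    (∀ i → q (letter w i) ≡ h i ℚ.- h (suc i)) →
    ∀ i n → total q (block w i n) ≡ h i ℚ.- h (i + n)
  total-telescope q h step i zero = sym (trans
    (cong (λ j → h i ℚ.- h j) (ℕ.+-identityʳ i)) (ℚ.+-inverseʳ (h i)))
  total-telescope q h step i (suc n) = begin
    total q (block w i (suc n))
      ≡⟨ cong (total q) (block-∷ i n) ⟩
    q (letter w i) ℚ.+ total q (block w (suc i) n)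
      ≡⟨ cong₂ ℚ._+_ (step i) (total-telescope q h step (suc i) n) ⟩
    (h i ℚ.- h (suc i)) ℚ.+ (h (suc i) ℚ.- h (suc i + n))
      ≡⟨ collapse (h i) (h (suc i)) (h (suc i + n)) ⟩
    h i ℚ.- h (suc i + n)
      ≡⟨ cong (λ j → h i ℚ.- h j) (sym (ℕ.+-suc i n)) ⟩
    h i ℚ.- h (i + suc n) ∎
    where
    open ≡-Reasoning
    collapse : ∀ a b c → (a ℚ.- b) ℚ.+ (b ℚ.- c) ≡ a ℚ.- c
    collapse = solve 3 (λ a b c → (a :- b) :+ (b :- c) := a :- c) refl
      where open +-*-Solver

∣term∣≤∑∣∣ : ∀ {n} (y : Fin n → ℚ) j → ℚ.∣ y j ∣ ℚ.≤ ∑.sum (ℚ.∣_∣ ∘ y)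
∑∣∣-nonNeg : ∀ {n} (y : Fin n → ℚ) → 0ℚ ℚ.≤ ∑.sum (ℚ.∣_∣ ∘ y)
∑∣∣-nonNeg {zero}  y = ℚ.≤-refl
∑∣∣-nonNeg {suc n} y = ℚ.+-mono-≤ (ℚ.0≤∣p∣ (y zero)) (∑∣∣-nonNeg (y ∘ suc))
∣term∣≤∑∣∣ y zero = subst (ℚ._≤ ∑.sum (ℚ.∣_∣ ∘ y)) (ℚ.+-identityʳ ℚ.∣ y zero ∣)
  (ℚ.+-monoʳ-≤ ℚ.∣ y zero ∣ (∑∣∣-nonNeg (y ∘ suc)))
∣term∣≤∑∣∣ y (suc j) = subst (ℚ._≤ ∑.sum (ℚ.∣_∣ ∘ y)) (ℚ.+-identityˡ ℚ.∣ y (suc j) ∣)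
  (ℚ.+-mono-≤ (ℚ.0≤∣p∣ (y zero)) (∣term∣≤∑∣∣ (y ∘ suc) j))

lookup-linear : ∀ {m} (j : Fin m) → Linear (λ x → lookup x j)
lookup-linear j c x y = lookup-zipWith (λ a b → c ℚ.* a ℚ.+ b) j x y

0-linear : ∀ {m} → Linear {m} (λ _ → 0ℚ)
0-linear c _ _ = sym (trans (ℚ.+-identityʳ (c ℚ.* 0ℚ)) (ℚ.*-zeroʳ c))

sub-linear : ∀ {m} {K L : Vec ℚ m → ℚ} → Linear K → Linear L → Linear (λ x → K x ℚ.- L x)
sub-linear {K = K} {L} K-linear L-linear c x y = trans
  (cong₂ ℚ._-_ (K-linear c x y) (L-linear c x y)) (regroup c (K x) (K y) (L x) (L y))
  where
  regroup : ∀ c a b a′ b′ →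
    (c ℚ.* a ℚ.+ b) ℚ.- (c ℚ.* a′ ℚ.+ b′) ≡ c ℚ.* (a ℚ.- a′) ℚ.+ (b ℚ.- b′)
  regroup = solve 5 (λ c a b a′ b′ →
    (c :* a :+ b) :- (c :* a′ :+ b′) := c :* (a :- a′) :+ (b :- b′)) refl
    where open +-*-Solver

module Walk {d} (w : InfiniteWord d) (independent : RationallyIndependentFrequencies w)
  {A : Set} (_≟_ : DecidableEquality A) (vertex : ℕ → A) where

  Balanced : (Fin d → ℚ) → (A → ℚ) → ℕ → Set
  Balanced q h i = q (letter w i) ≡ h (vertex i) ℚ.- h (vertex (suc i))

  -- Telescoping bounds every prefix sum by 2B, so the weights vanish; each balance equation then
  -- equates the potentials of two consecutive vertices.
  balanced⇒trivial : ∀ {q h B} → (∀ v → ℚ.∣ h v ∣ ℚ.≤ B) → (∀ i → Balanced q h i) →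
    (∀ a → q a ≡ 0ℚ) × (∀ i → h (vertex i) ≡ h (vertex 0))
  balanced⇒trivial {q} {h} {B} ∣h∣≤B balanced = q≡0 , constant
    where
    bound : ∀ n → ℚ.∣ total q (prefix w n) ∣ ℚ.≤ B ℚ.+ B
    bound n = begin
      ℚ.∣ total q (prefix w n) ∣
        ≡⟨ cong ℚ.∣_∣ (total-telescope w q (h ∘ vertex) balanced 0 n) ⟩
      ℚ.∣ h (vertex 0) ℚ.- h (vertex n) ∣
        ≤⟨ ℚ.∣p-q∣≤∣p∣+∣q∣ (h (vertex 0)) (h (vertex n)) ⟩
      ℚ.∣ h (vertex 0) ∣ ℚ.+ ℚ.∣ h (vertex n) ∣
        ≤⟨ ℚ.+-mono-≤ (∣h∣≤B (vertex 0)) (∣h∣≤B (vertex n)) ⟩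
      B ℚ.+ B ∎
      where open ℚ.≤-Reasoning

    q≡0 : ∀ a → q a ≡ 0ℚ
    q≡0 = bounded⇒≡0 w independent q (B ℚ.+ B) bound

    constant : ∀ i → h (vertex i) ≡ h (vertex 0)
    constant zero    = refl
    constant (suc i) = trans
      (sym (ℚ+.x∙y⁻¹≈ε⇒x≈y (h (vertex i)) (h (vertex (suc i)))
        (trans (sym (balanced i)) (q≡0 (letter w i)))))
      (constant i)

  -- Letter weights together with potentials on V visited vertices form a space of
  -- dimension d + V in which, once h (vertex 0) = 0 is imposed, only 0 is balanced everywhere.
  rank-inequality : ∀ {V k} (v : Fin V → A) → Injective _≡_ _≡_ v →
    (∀ j → ∃[ i ] vertex i ≡ v j) →
    (position : Fin k → ℕ) →
    (∀ q h → (∀ r → Balanced q h (position r)) → ∀ i → Balanced q h i) →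
    d + V ≤ suc k
  rank-inequality {V} {k} v v-injective visited position determines =
    ℕ.≮⇒≥ λ suck<d+V → contradict (nonTrivialZero suck<d+V equation equation-linear)
    where
    -- Potentials are extended by 0 outside the image of `v`. The decision is an explicit argument
    -- so that linearity follows by cases on it, with the same choice for all vectors.
    value : ∀ {a} → Vec ℚ (d + V) → Dec (∃[ j ] v j ≡ a) → ℚ
    value x (yes (j , _)) = lookup x (d ↑ʳ j)
    value x (no _)        = 0ℚ

    value-linear : ∀ {a} (a? : Dec (∃[ j ] v j ≡ a)) → Linear (λ x → value x a?)
    value-linear (yes (j , _)) = lookup-linear (d ↑ʳ j)
    value-linear (no _)        = 0-linear

    find : ∀ a → Dec (∃[ j ] v j ≡ a)
    find a = any? (λ j → v j ≟ a)

    weight : Vec ℚ (d + V) → Fin d → ℚ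
    weight x a = lookup x (a ↑ˡ V)

    potential : Vec ℚ (d + V) → A → ℚ
    potential x a = value x (find a)

    potential-v : ∀ x j → potential x (v j) ≡ lookup x (d ↑ʳ j)
    potential-v x j with find (v j)
    ... | yes (j′ , eq) = cong (λ j → lookup x (d ↑ʳ j)) (v-injective eq)
    ... | no ∄j         = contradiction (j , refl) ∄j

    potential-bounded : ∀ x a → ℚ.∣ potential x a ∣ ℚ.≤ ∑.sum (λ j → ℚ.∣ lookup x (d ↑ʳ j) ∣)
    potential-bounded x a with find a
    ... | yes (j , _) = ∣term∣≤∑∣∣ (λ j → lookup x (d ↑ʳ j)) j
    ... | no _        = ∑∣∣-nonNeg (λ j → lookup x (d ↑ʳ j))

    edge : ℕ → Vec ℚ (d + V) → ℚ
    edge i x = weight x (letter w i) ℚ.-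
      (potential x (vertex i) ℚ.- potential x (vertex (suc i)))

    equation : Fin (suc k) → Vec ℚ (d + V) → ℚ
    -- Normalising the potential removes the additive constant. This one equation is the 1 in the
    -- bound `suc k`.
    equation zero    x = potential x (vertex 0)
    equation (suc r) x = edge (position r) x

    edge-linear : ∀ i → Linear (edge i)
    edge-linear i = sub-linear {K = λ x → weight x (letter w i)}
      {λ x → potential x (vertex i) ℚ.- potential x (vertex (suc i))}
      (lookup-linear (letter w i ↑ˡ V))
      (sub-linear {K = λ x → potential x (vertex i)} {λ x → potential x (vertex (suc i))}
        (value-linear (find (vertex i))) (value-linear (find (vertex (suc i)))))

    equation-linear : ∀ r → Linear (equation r)
    equation-linear zero    = value-linear (find (vertex 0))
    equation-linear (suc r) = edge-linear (position r)

    contradict : ¬ NonTrivialZero equation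
    contradict (x , x≢0 , equation≡0) = x≢0 x≡0
      where
      trivial : (∀ a → weight x a ≡ 0ℚ) ×
        (∀ i → potential x (vertex i) ≡ potential x (vertex 0))
      trivial = balanced⇒trivial {weight x} {potential x} (potential-bounded x)
        (determines (weight x) (potential x)
          (λ r → ℚ+.x∙y⁻¹≈ε⇒x≈y _ _ (equation≡0 (suc r))))

      potential≡0 : ∀ j → lookup x (d ↑ʳ j) ≡ 0ℚ
      potential≡0 j with i , eq ← visited j = begin
        lookup x (d ↑ʳ j)         ≡⟨ sym (potential-v x j) ⟩
        potential x (v j)         ≡⟨ cong (potential x) (sym eq) ⟩
        potential x (vertex i)    ≡⟨ proj₂ trivial i ⟩
        potential x (vertex 0)    ≡⟨ equation≡0 zero ⟩
        0ℚ                        ∎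
        where open ≡-Reasoning

      x≡0 : ∀ m → lookup x m ≡ 0ℚ
      x≡0 m with splitAt d m in eq
      ... | inj₁ a = trans (cong (lookup x) (sym (Fin.splitAt⁻¹-↑ˡ eq))) (proj₁ trivial a)
      ... | inj₂ j = trans (cong (lookup x) (sym (Fin.splitAt⁻¹-↑ʳ eq))) (potential≡0 j)

-- Factors and extension graphs

_≟ᵥ_ : ∀ {d n} → DecidableEquality (Vec (Fin d) n)
_≟ᵥ_ = ≡-dec Fin._≟_

constant-chain : ∀ {X : Set} m (f : Fin (suc m) → X) →
  (∀ i → f (inject₁ i) ≡ f (suc i)) → f zero ≡ f (fromℕ m)
constant-chain zero    f step = refl
constant-chain (suc m) f step = trans (step zero) (constant-chain m (f ∘ suc) (step ∘ suc))

-- As `d′ * suc m` is `d′ + d′ * m`, the left side exceeds the right by exactly 1. This is where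
-- equality d + V = E + 1 for Rauzy graphs enters: gaining one vertex or losing one equation is
-- impossible.
complexity-gap : ∀ d′ m → ¬ (suc d′ + (d′ * m + 1) ≤ d′ * suc m + 1)
complexity-gap d′ m le = ℕ.<-irrefl refl
  (subst (suc d′ + (d′ * m + 1) ≤_)
    (trans (cong (_+ 1) (ℕ.*-suc d′ m)) (ℕ.+-assoc d′ (d′ * m) 1)) le)

module _ {d} (w : InfiniteWord d) where

  -- Occurrence is a search over all positions of an infinite word; the finite enumeration given by
  -- the complexity turns it into a decidable one.
  𝓛? : ∀ {n k} → HasComplexity w n k → Decidable₁ (𝓛 w n)
  𝓛? (e , _ , char) u = map′ (Equivalence.from (char u)) (Equivalence.to (char u))
    (any? (λ i → e i ≟ᵥ u))

  edge-at : ∀ {n} {u : Vec (Fin d) n} i → block w (suc i) n ≡ u →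
    letter w i ∷ (u ∷ʳ letter w (suc i + n)) ∈ 𝓛 w (2 + n)
  edge-at {n} i eq = i , trans (block-∷ w i (suc n))
    (cong (letter w i ∷_) (trans (block-∷ʳ w (suc i) n) (cong (_∷ʳ letter w (suc i + n)) eq)))

  module _ {n} (u : Vec (Fin d) n) where

    edgeWord : ∀ x y → ExtEdge w u x y → Vec (Fin d) (2 + n)
    edgeWord (inj₁ a) (inj₂ b) _ = a ∷ (u ∷ʳ b)
    edgeWord (inj₂ b) (inj₁ a) _ = a ∷ (u ∷ʳ b)

    edgeWord∈𝓛 : ∀ x y xy → edgeWord x y xy ∈ 𝓛 w (2 + n)
    edgeWord∈𝓛 (inj₁ a) (inj₂ b) xy = xy
    edgeWord∈𝓛 (inj₂ b) (inj₁ a) xy = xy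

    private
      ends : ∀ {a a′ b b′} → a ∷ (u ∷ʳ b) ≡ a′ ∷ (u ∷ʳ b′) → a ≡ a′ × b ≡ b′
      ends eq = ∷-injectiveˡ eq , ∷ʳ-injectiveʳ u u (∷-injectiveʳ eq)

    -- The end letters are read off the word, as `u` is fixed. The second alternative arises because
    -- both orientations of an edge spell the same word.
    edgeWord-injective : ∀ x y x′ y′ xy xy′ → edgeWord x y xy ≡ edgeWord x′ y′ xy′ →
      (x ≡ x′ × y ≡ y′) ⊎ (x ≡ y′ × y ≡ x′)
    edgeWord-injective (inj₁ a) (inj₂ b) (inj₁ a′) (inj₂ b′) _ _ eq with refl , refl ← ends eq =
      inj₁ (refl , refl)
    edgeWord-injective (inj₁ a) (inj₂ b) (inj₂ b′) (inj₁ a′) _ _ eq with refl , refl ← ends eq =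
      inj₂ (refl , refl)
    edgeWord-injective (inj₂ b) (inj₁ a) (inj₁ a′) (inj₂ b′) _ _ eq with refl , refl ← ends eq =
      inj₂ (refl , refl)
    edgeWord-injective (inj₂ b) (inj₁ a) (inj₂ b′) (inj₁ a′) _ _ eq with refl , refl ← ends eq =
      inj₁ (refl , refl)

-- A cycle in the extension graph of u makes one of its edges redundant in the walk
-- on factors of length n + 1.
module _ {d n k} (w : InfiniteWord d) (independent : RationallyIndependentFrequencies w)
  (u : Vec (Fin d) n) (edges : HasComplexity w (2 + n) (suc k)) where

  private
    open Walk w independent _≟ᵥ_ (λ i → block w i (suc n))

    e : Fin (suc k) → Vec (Fin d) (2 + n)
    e = proj₁ edges

    e∈𝓛 : ∀ r → e r ∈ 𝓛 w (2 + n)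
    e∈𝓛 r = Equivalence.from (proj₂ (proj₂ edges) (e r)) (r , refl)

    module Potential (q : Fin d → ℚ) (h : Vec (Fin d) (suc n) → ℚ) where

      -- Chosen so that the balance equation q a = h (au) - h (ub) of the edge aub becomes
      -- `θ (inj₁ a) ≡ θ (inj₂ b)`: balance means that `θ` is constant along edges of the extension
      -- graph.
      θ : Fin d ⊎ Fin d → ℚ
      θ (inj₁ a) = h (a ∷ u) ℚ.- q a
      θ (inj₂ b) = h (u ∷ʳ b)

      sub-sub : ∀ s t → s ℚ.- (s ℚ.- t) ≡ t
      sub-sub = solve 2 (λ s t → s :- (s :- t) := t) refl
        where open +-*-Solver

      module _ {a b i} (eq : block w i (2 + n) ≡ a ∷ (u ∷ʳ b)) where

        letter≡ : letter w i ≡ a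
        letter≡ = ∷-injectiveˡ (trans (sym (block-∷ w i (suc n))) eq)

        source≡ : block w i (suc n) ≡ a ∷ u
        source≡ = ∷ʳ-injectiveˡ _ (a ∷ u) (trans (sym (block-∷ʳ w i (suc n))) eq)

        target≡ : block w (suc i) (suc n) ≡ u ∷ʳ b
        target≡ = ∷-injectiveʳ (trans (sym (block-∷ w i (suc n))) eq)

        balanced⇒θ≡ : Balanced q h i → θ (inj₁ a) ≡ θ (inj₂ b)
        balanced⇒θ≡ balanced rewrite letter≡ | source≡ | target≡ =
          trans (cong (λ z → h (a ∷ u) ℚ.- z) balanced) (sub-sub (h (a ∷ u)) (h (u ∷ʳ b)))

        θ≡⇒balanced : θ (inj₁ a) ≡ θ (inj₂ b) → Balanced q h i
        θ≡⇒balanced θ≡ rewrite letter≡ | source≡ | target≡ =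
          trans (sym (sub-sub (h (a ∷ u)) (q a))) (cong (λ z → h (a ∷ u) ℚ.- z) θ≡)

      edge-balanced⇒θ≡ : ∀ x y xy {i} → block w i (2 + n) ≡ edgeWord w u x y xy →
        Balanced q h i → θ x ≡ θ y
      edge-balanced⇒θ≡ (inj₁ a) (inj₂ b) _ eq balanced = balanced⇒θ≡ eq balanced
      edge-balanced⇒θ≡ (inj₂ b) (inj₁ a) _ eq balanced = sym (balanced⇒θ≡ eq balanced)

      edge-θ≡⇒balanced : ∀ x y xy {i} → block w i (2 + n) ≡ edgeWord w u x y xy →
        θ x ≡ θ y → Balanced q h i
      edge-θ≡⇒balanced (inj₁ a) (inj₂ b) _ eq θ≡ = θ≡⇒balanced eq θ≡
      edge-θ≡⇒balanced (inj₂ b) (inj₁ a) _ eq θ≡ = θ≡⇒balanced eq (sym θ≡)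

    -- A factor of length n + 2 determines the letter, the source and the target of its step, so one
    -- occurrence of each factor is enough to test.
    balanced-local : ∀ q h {i j} → block w i (2 + n) ≡ block w j (2 + n) →
      Balanced q h i → Balanced q h j
    balanced-local q h {i} {j} eq balanced = begin
      q (letter w j)
        ≡⟨ cong q (∷-injectiveˡ (sym eq′)) ⟩
      q (letter w i)
        ≡⟨ balanced ⟩
      h (block w i (suc n)) ℚ.- h (block w (suc i) (suc n))
        ≡⟨ cong₂ (λ s t → h s ℚ.- h t) source≡ (∷-injectiveʳ eq′) ⟩
      h (block w j (suc n)) ℚ.- h (block w (suc j) (suc n)) ∎
      where
      open ≡-Reasoning
      eq′ : letter w i ∷ block w (suc i) (suc n) ≡ letter w j ∷ block w (suc j) (suc n)
      eq′ = trans (sym (block-∷ w i (suc n))) (trans eq (block-∷ w j (suc n)))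
      source≡ : block w i (suc n) ≡ block w j (suc n)
      source≡ = ∷ʳ-injectiveˡ _ _
        (trans (sym (block-∷ʳ w i (suc n))) (trans eq (block-∷ʳ w j (suc n))))

  cycle⇒rank-bound : ∀ {V} → HasComplexity w (suc n) V → Cycle (extensionGraph w u) → d + V ≤ suc k
  cycle⇒rank-bound (v , v-injective , v-char) C =
    rank-inequality v v-injective (λ j → Equivalence.from (v-char (v j)) (j , refl))
      position determines
    where
    open Cycle C renaming (k to l)

    last : Fin (3 + l)
    last = fromℕ (2 + l)

    closingWord : Vec (Fin d) (2 + n)
    closingWord = edgeWord w u (c last) (c zero) closing

    r₀ : ∃[ r ] e r ≡ closingWord
    r₀ = Equivalence.to (proj₂ (proj₂ edges) closingWord)
      (edgeWord∈𝓛 w u (c last) (c zero) closing)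

    -- One occurrence of every factor of length n + 2 except the closing word of the cycle.
    position : Fin k → ℕ
    position r = proj₁ (e∈𝓛 (punchIn (proj₁ r₀) r))

    represented : ∀ {f} → f ∈ 𝓛 w (2 + n) → f ≢ closingWord →
      ∃[ r ] block w (position r) (2 + n) ≡ f
    represented {f} f∈𝓛 f≢closing with s , es≡f ← Equivalence.to (proj₂ (proj₂ edges) f) f∈𝓛 =
      punchOut r₀≢s , trans (proj₂ (e∈𝓛 _)) (trans (cong e (punchIn-punchOut r₀≢s)) es≡f)
      where
      r₀≢s : proj₁ r₀ ≢ s
      r₀≢s refl = f≢closing (trans (sym es≡f) (proj₂ r₀))

    -- Distinctness of the cycle vertices rules out a repeated edge. In the reversed orientation
    -- with `i` equal to `zero`, it matters that the cycle has at least three vertices: otherwise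
    -- `suc zero` would be `last`.
    not-closing : ∀ (i : Fin (2 + l)) →
      edgeWord w u (c (inject₁ i)) (c (suc i)) (adjacent i) ≢ closingWord
    not-closing i eq
      with edgeWord-injective w u (c (inject₁ i)) (c (suc i)) (c last) (c zero) (adjacent i) closing eq
    ... | inj₁ (_ , c≡) with () ← distinct c≡
    not-closing zero    eq | inj₂ (_ , c≡) with () ← distinct c≡
    not-closing (suc i) eq | inj₂ (c≡ , _) with () ← distinct c≡

    determines : ∀ q h → (∀ r → Balanced q h (position r)) → ∀ i → Balanced q h i
    determines q h balanced i with block w i (2 + n) ≟ᵥ closingWord
    ... | no ≢closing with r , eq ← represented (i , refl) ≢closing =
      balanced-local q h eq (balanced r)
    -- The omitted equation follows from the others: `θ` is constant along the path from `c zero` to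
    -- `c last`, hence equal at the ends of the closing edge.
    ... | yes ≡closing = edge-θ≡⇒balanced (c last) (c zero) closing ≡closing
      (sym (constant-chain (2 + l) (θ ∘ c) step))
      where
      open Potential q h
      step : ∀ j → θ (c (inject₁ j)) ≡ θ (c (suc j))
      step j with r , eq ← represented
          (edgeWord∈𝓛 w u (c (inject₁ j)) (c (suc j)) (adjacent j)) (not-closing j) =
        edge-balanced⇒θ≡ (c (inject₁ j)) (c (suc j)) (adjacent j) eq (balanced r)

-- A union S of components of the extension graph of u splits the vertex u of the
-- Rauzy graph in two, and the walk of w lifts to the split graph.
module _ {d n p k} (w : InfiniteWord d) (independent : RationallyIndependentFrequencies w)
  (u : Vec (Fin d) n) (vertices : HasComplexity w n p) (edges : HasComplexity w (suc n) k)
  {S : Fin d ⊎ Fin d → Set} (S? : Decidable₁ S) (S-closed : ∀ x y → ExtEdge w u x y → S x → S y)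
  where

  split-rank-bound :
    ∃[ i ] block w i n ≡ u × S (inj₂ (letter w (i + n))) →
    ∃[ i ] block w i n ≡ u × ¬ S (inj₂ (letter w (i + n))) →
    d + suc p ≤ suc k
  split-rank-bound (i₁ , i₁≡u , i₁∈S) (i₂ , i₂≡u , i₂∉S) =
    rank-inequality v v-injective visited position determines
    where
    inS? : ∀ i → Dec (block w i n ≡ u × S (inj₂ (letter w (i + n))))
    inS? i = (block w i n ≟ᵥ u) ×-dec S? (inj₂ (letter w (i + n)))

    -- The flag looks one letter ahead: it marks those visits to `u` whose next letter lies in `S`.
    vertex : ℕ → Vec (Fin d) n × Bool
    vertex i = block w i n , does (inS? i)

    open Walk w independent (×-≡-dec _≟ᵥ_ Bool._≟_) vertex

    v : Fin (suc p) → Vec (Fin d) n × Bool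
    v zero    = u , true
    v (suc j) = proj₁ vertices j , false

    v-injective : Injective _≡_ _≡_ v
    v-injective {zero}  {zero}  eq = refl
    v-injective {suc i} {suc j} eq = cong suc (proj₁ (proj₂ vertices) (,-injectiveˡ eq))
    v-injective {zero}  {suc j} eq with () ← ,-injectiveʳ eq
    v-injective {suc i} {zero}  eq with () ← ,-injectiveʳ eq

    visited : ∀ j → ∃[ i ] vertex i ≡ v j
    visited zero = i₁ , cong₂ _,_ i₁≡u (dec-true (inS? i₁) (i₁≡u , i₁∈S))
    visited (suc j) with proj₁ vertices j ≟ᵥ u
    -- The unmarked copy of `u` needs a visit followed by a letter outside `S`; the second
    -- occurrence supplies it.
    ... | yes ≡u = i₂ , cong₂ _,_ (trans i₂≡u (sym ≡u)) (dec-false (inS? i₂) (i₂∉S ∘ proj₂))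
    ... | no ≢u with i , eq ← Equivalence.from (proj₂ (proj₂ vertices) (proj₁ vertices j)) (j , refl) =
      i , cong₂ _,_ eq (dec-false (inS? i) (λ (≡u , _) → ≢u (trans (sym eq) ≡u)))

    -- S is closed under edges, so the left letter of an edge decides the side of its right letter.
    side-suc : ∀ i → does (inS? (suc i)) ≡
      does ((block w (suc i) n ≟ᵥ u) ×-dec S? (inj₁ (letter w i)))
    side-suc i = does-⇔ (mk⇔
      (λ (≡u , s) → ≡u , S-closed (inj₂ _) (inj₁ _) (edge-at w i ≡u) s)
      (λ (≡u , s) → ≡u , S-closed (inj₁ _) (inj₂ _) (edge-at w i ≡u) s))
      (inS? (suc i)) ((block w (suc i) n ≟ᵥ u) ×-dec S? (inj₁ (letter w i)))

    -- Splitting `u` creates no new edges: a factor of length n + 1 fixes the flag of its source by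
    -- its last letter and, through `side-suc`, that of its target by its first letter. Hence `k`
    -- equations still suffice.
    module _ {i j} (eq : block w i (suc n) ≡ block w j (suc n)) where

      tail≡ : letter w i ∷ block w (suc i) n ≡ letter w j ∷ block w (suc j) n
      tail≡ = trans (sym (block-∷ w i n)) (trans eq (block-∷ w j n))

      init≡ : block w i n ≡ block w j n × letter w (i + n) ≡ letter w (j + n)
      init≡ = ∷ʳ-injective _ _ (trans (sym (block-∷ʳ w i n)) (trans eq (block-∷ʳ w j n)))

      vertex≡ : vertex i ≡ vertex j
      vertex≡ = cong₂ (λ f b → f , does ((f ≟ᵥ u) ×-dec S? (inj₂ b))) (proj₁ init≡) (proj₂ init≡)

      vertex-suc≡ : vertex (suc i) ≡ vertex (suc j)
      vertex-suc≡ = cong₂ _,_ (∷-injectiveʳ tail≡) (trans (side-suc i) (trans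
        (cong₂ (λ f a → does ((f ≟ᵥ u) ×-dec S? (inj₁ a))) (∷-injectiveʳ tail≡) (∷-injectiveˡ tail≡))
        (sym (side-suc j))))

    e∈𝓛 : ∀ r → proj₁ edges r ∈ 𝓛 w (suc n)
    e∈𝓛 r = Equivalence.from (proj₂ (proj₂ edges) (proj₁ edges r)) (r , refl)

    position : Fin k → ℕ
    position r = proj₁ (e∈𝓛 r)

    determines : ∀ q h → (∀ r → Balanced q h (position r)) → ∀ i → Balanced q h i
    determines q h balanced i
      with r , er≡ ← Equivalence.to (proj₂ (proj₂ edges) (block w i (suc n))) (i , refl) = begin
      q (letter w i)
        ≡⟨ cong q (∷-injectiveˡ (tail≡ eq)) ⟩
      q (letter w (position r))
        ≡⟨ balanced r ⟩
      h (vertex (position r)) ℚ.- h (vertex (suc (position r)))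
        ≡⟨ cong₂ (λ s t → h s ℚ.- h t) (sym (vertex≡ eq)) (sym (vertex-suc≡ eq)) ⟩
      h (vertex i) ℚ.- h (vertex (suc i)) ∎
      where
      open ≡-Reasoning
      eq : block w i (suc n) ≡ block w (position r) (suc n)
      eq = sym (trans (proj₂ (e∈𝓛 r)) er≡)

-- Connectedness and the final count

module _ {d n} (w : InfiniteWord d) (u : Vec (Fin d) n) where

  -- Reduces connectedness to right letters that follow actual occurrences of `u`. An occurrence of
  -- au is followed by some letter b of the infinite word, which gives the edge from a to b.
  right-neighbour : ∀ x → ExtVertex w u x →
    ∃[ i ] block w i n ≡ u × Star (ExtEdge w u) x (inj₂ (letter w (i + n)))
  right-neighbour (inj₂ b) (i , eq)
    with ≡u , refl ← ∷ʳ-injective _ u (trans (sym (block-∷ʳ w i n)) eq) = i , ≡u , ε⋆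
  right-neighbour (inj₁ a) (i , eq)
    with refl , ≡u ← ∷-injective (trans (sym (block-∷ w i n)) eq) =
    suc i , ≡u , edge-at w i ≡u ◅ ε⋆

module _ {d} (w : InfiniteWord d) (independent : RationallyIndependentFrequencies w) where

  -- If right letters reached from `x` and `y` are not joined, the component of the first one serves
  -- as `S`, and both sides of the split are visited. Decidable reachability makes the case
  -- distinction constructive.
  ¬rank-bound⇒connected : ∀ {n p k l} (u : Vec (Fin d) n) → HasComplexity w n p →
    HasComplexity w (1 + n) k → HasComplexity w (2 + n) l → ¬ (d + suc p ≤ suc k) →
    Connected (extensionGraph w u)
  ¬rank-bound⇒connected u vertices edges edges₂ ¬bound {x} {y} x∈ y∈
    with i , i≡u , x⋆i ← right-neighbour w u x x∈ | j , j≡u , y⋆j ← right-neighbour w u y y∈ =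
    connect (via? (⊎-≡-dec Fin._≟_ Fin._≟_) edge? all (inj₂ (letter w (i + _))) (inj₂ (letter w (j + _))))
    where
    open Graph (extensionGraph w u) using (edge-sym)
    open Reachability (ExtEdge w u)

    all : List (Fin d ⊎ Fin d)
    all = map inj₁ (allFin d) ++ map inj₂ (allFin d)

    ∈-all : ∀ z → z ∈ₗ all
    ∈-all (inj₁ a) = ∈-++⁺ˡ (∈-map⁺ inj₁ (∈-allFin a))
    ∈-all (inj₂ b) = ∈-++⁺ʳ (map inj₁ (allFin d)) (∈-map⁺ inj₂ (∈-allFin b))

    edge? : Decidable (ExtEdge w u)
    edge? (inj₁ a) (inj₂ b) = 𝓛? w edges₂ (a ∷ (u ∷ʳ b))
    edge? (inj₂ b) (inj₁ a) = 𝓛? w edges₂ (a ∷ (u ∷ʳ b))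
    edge? (inj₁ _) (inj₁ _) = no λ ()
    edge? (inj₂ _) (inj₂ _) = no λ ()

    connect : Dec (Via all (inj₂ (letter w (i + _))) (inj₂ (letter w (j + _)))) →
      Star (ExtEdge w u) x y
    connect (yes i⋆j) = x⋆i ◅◅ via⇒star all i⋆j ◅◅ reverse (λ {x} {y} → edge-sym {x} {y}) y⋆j
    connect (no ¬i⋆j) = contradiction
      (split-rank-bound w independent u vertices edges
        (via? (⊎-≡-dec Fin._≟_ Fin._≟_) edge? all (inj₂ (letter w (i + _))))
        (λ x y xy s → via-trans (∈-all x) s (edge⇒via all xy))
        (i , i≡u , via-refl all) (j , j≡u , ¬i⋆j))
      ¬bound

theorem3p2 : (d : ℕ) → 1 ≤ d → (w : InfiniteWord d) →
    RationallyIndependentFrequencies w →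
    (∀ n → HasComplexity w n ((d ∸ 1) * n + 1)) →
    Dendric w
theorem3p2 (suc d′) _ w independent complexity n u _ = connected , acyclic
  where
  connected : Connected (extensionGraph w u)
  connected = ¬rank-bound⇒connected w independent u
    (complexity n) (complexity (1 + n)) (complexity (2 + n))
    λ bound → complexity-gap d′ n
      -- Here V is p(n) + 1 and E is p(n+1); cancelling one successor on each side leaves the
      -- excluded inequality.
      (s≤s⁻¹ (subst (_≤ suc (d′ * suc n + 1)) (ℕ.+-suc (suc d′) (d′ * n + 1)) bound))

  acyclic : Acyclic (extensionGraph w u)
  acyclic C = complexity-gap d′ (suc n)
    (subst (suc d′ + (d′ * suc n + 1) ≤_) (sym p≡)
      -- The number of edges p(n+2) is written as a successor so that one edge can be omitted; the
      -- bound becomes d + p(n+1) ≤ p(n+2).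
      (cycle⇒rank-bound w independent u (subst (HasComplexity w (2 + n)) p≡ (complexity (2 + n)))
        (complexity (suc n)) C))
    where
    p≡ : d′ * (2 + n) + 1 ≡ suc (d′ * (2 + n))
    p≡ = ℕ.+-comm (d′ * (2 + n)) 1
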